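{- Let $q$ be a power of an odd prime and let $E\subset\mathbb F_q^d$ with $|E|\ge q^{\frac{d+1}{2}}$. Then there exists a subset $E'\subset E$ with $|E'|\gtrsim|E|$ such that for every $y\in E'$, $$|\Pi_y(E)|>\frac q2,\qquad\text{where }\Pi_y(E)=\{x\cdot y: x\in E\}.$$
   Context: $\mathbb F_q$ is the finite field with $q$ elements and $x\cdot y=\sum_{i=1}^d x_iy_i$. The notation $X\gtrsim Y$ means $X\ge cY$ for a constant $c>0$ independent of $q$ and $E$. -}

module Defs where

open import Level using (0ℓ)
open import Data.Nat using (ℕ)
open import Data.Fin using (Fin)
open import Data.Vec using (Vec; zipWith; foldr)
open import Data.Vec.Properties using (≡-dec)
open import Data.List using (List; map; length; deduplicate)
open import Data.Product using (∃)
open import Relation.Nullary using (¬_)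
open import Relation.Binary.Definitions using (DecidableEquality)
open import Relation.Binary.PropositionalEquality using (_≡_)
open import Algebra.Structures using (IsCommutativeRing)
open import Function.Bundles using (_↔_)

record FiniteField (q : ℕ) : Set₁ where
  infixl 7 _*_
  infixl 6 _+_
  field
    F    : Set
    _+_  : F → F → F
    _*_  : F → F → F
    -_   : F → F
    0#   : F
    1#   : F
    isCommutativeRing : IsCommutativeRing _≡_ _+_ _*_ -_ 0# 1#
    0≢1  : ¬ (0# ≡ 1#)
    inverse : ∀ x → ¬ (x ≡ 0#) → ∃ λ y → x * y ≡ 1#
    _≟_  : DecidableEquality F
    enum : F ↔ Fin q

module _ {q : ℕ} (𝔽 : FiniteField q) where
  open FiniteField 𝔽

  dot : ∀ {d} → Vec F d → Vec F d → F
  dot x y = foldr (λ _ → F) _+_ 0# (zipWith _*_ x y)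

  -- |Π_y(E)| where Π_y(E) = { x · y : x ∈ E }, E given as a duplicate-free list
  projCard : ∀ {d} → Vec F d → List (Vec F d) → ℕ
  projCard y E = length (deduplicate _≟_ (map (λ x → dot x y) E))

  vecDec : ∀ {d} → DecidableEquality (Vec F d)
  vecDec = ≡-dec _≟_

{-# OPTIONS --safe #-}
-- For y ∈ 𝔽_q^d let K(y) = #{(x,x') ∈ E² : x·y = x'·y} and n = |E|.  Exchanging
-- the order of summation gives q Σ_y K(y) ≤ q^d n² + (q-1) q^d n, while
-- Cauchy–Schwarz gives n² ≤ |Π_y(E)| K(y).  Call y bad if |Π_y(E)| ≤ q/2; then
-- q K(y) ≥ 2n², so the number b of bad y ∈ 𝔽_q^d satisfies q b ≤ (q-1) n.  This
-- leaves at least n/q good points of E, which is enough for bounded q.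
--
-- For large q the invariance of badness under scaling is needed.  Call x ∈ E
-- rich if more than q/2 multiples s x (s ∈ 𝔽_q) lie in E.  A rich x is
-- orthogonal to every bad y, since otherwise the values s(x·y) already fill more
-- than half of 𝔽_q.  The bad points of E that are not rich number at most n/2, as
-- at most q/2 of the q-1 nonzero multiples of a bad vector can be such points.
-- Hence, if fewer than n/4 points of E are good, at least n/4 are rich, so
-- K(y) ≥ n²/16 for all bad y; fed back into the bound for Σ K this gives b ≤ n/2,
-- contradicting b > 3n/4.
module Submission where

open import Defs
open import Data.Nat using (ℕ; _*_; _^_; _≤_; _<_; suc; NonZero)
open import Data.Nat using (zero; _+_; z≤n; s≤s; _<?_; _≤?_; ≢-nonZero)
open import Data.Nat.ListAction using (sum)
open import Data.Nat.Primality using (Prime)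
open import Data.Nat.Properties hiding (_≟_; _<?_; _≤?_)
open import Data.Nat.Tactic.RingSolver using (solve-∀)
open import Data.List using (List; length)
open import Data.List using ([]; _∷_; _++_; map; filter; tabulate; deduplicate; cartesianProductWith)
open import Data.List.Properties using (length-tabulate; length-map)
open import Data.List.Relation.Unary.Unique.Propositional using (Unique)
open import Data.List.Relation.Unary.Unique.Propositional.Properties using () renaming (filter⁺ to Unique-filter⁺; map⁺ to Unique-map⁺; tabulate⁺ to Unique-tabulate⁺)
open import Data.List.Relation.Unary.Unique.DecPropositional.Properties using (deduplicate-!)
open import Data.List.Relation.Unary.AllPairs using ([]; _∷_)
open import Data.List.Relation.Unary.All using (All)
import Data.List.Relation.Unary.All as All
open import Data.List.Relation.Unary.All.Properties using (all-filter)
open import Data.List.Relation.Unary.Any using (here; there; any?)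
open import Data.List.Membership.Propositional using (_∈_)
open import Data.List.Membership.Propositional using (find; lose)
open import Data.List.Membership.Propositional.Properties using (∈-filter⁻; ∈-map⁺; ∈-map⁻; ∈-deduplicate⁺; ∈-deduplicate⁻; ∈-tabulate⁺; ∈-cartesianProductWith⁺)
import Data.List.Membership.DecPropositional as DecMembership
open import Data.Product using (Σ; ∃; _×_; _,_)
open import Data.Product using (proj₁; proj₂)
open import Data.Sum using (inj₁; inj₂)
open import Data.Vec using (Vec)
import Data.Vec as Vec
open import Data.Empty using (⊥-elim)
open import Function using (_∘_; id)
open import Function.Bundles using (module Inverse)
open import Algebra.Bundles using (CommutativeRing)
import Algebra.Solver.Ring.NaturalCoefficients.Default as SemiringSolver
open import Relation.Binary.Definitions using (DecidableEquality)
open import Relation.Binary.PropositionalEquality using (_≡_)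
open import Relation.Binary.PropositionalEquality using (_≢_; refl; sym; trans; cong; cong₂; subst; module ≡-Reasoning)
open import Relation.Nullary using (¬_)
open import Relation.Nullary using (Dec; yes; no; contradiction; ¬?)
open import Relation.Nullary.Decidable using (_×-dec_)
open import Relation.Unary using (Pred; Decidable)

private
  variable
    A B C : Set

-- Indicators and finite sums

⟦_⟧ : Dec A → ℕ
⟦ yes _ ⟧ = 1
⟦ no  _ ⟧ = 0

⟦⟧≤1 : (A? : Dec A) → ⟦ A? ⟧ ≤ 1
⟦⟧≤1 (yes _) = ≤-refl
⟦⟧≤1 (no  _) = z≤n

⟦⟧≥1 : (A? : Dec A) → A → 1 ≤ ⟦ A? ⟧
⟦⟧≥1 (yes _) _ = ≤-refl
⟦⟧≥1 (no ¬a) a = contradiction a ¬a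

⟦⟧-mono : (A? : Dec A) (B? : Dec B) → (A → B) → ⟦ A? ⟧ ≤ ⟦ B? ⟧
⟦⟧-mono (yes a) B? f = ⟦⟧≥1 B? (f a)
⟦⟧-mono (no  _) B? f = z≤n

∑ : List A → (A → ℕ) → ℕ
∑ xs f = sum (map f xs)

∑-cong : (xs : List A) {f g : A → ℕ} → (∀ x → f x ≡ g x) → ∑ xs f ≡ ∑ xs g
∑-cong []       e = refl
∑-cong (x ∷ xs) e = cong₂ _+_ (e x) (∑-cong xs e)

∑-mono-∈ : (xs : List A) {f g : A → ℕ} → (∀ {x} → x ∈ xs → f x ≤ g x) → ∑ xs f ≤ ∑ xs g
∑-mono-∈ []       h = z≤n
∑-mono-∈ (x ∷ xs) h = +-mono-≤ (h (here refl)) (∑-mono-∈ xs (h ∘ there))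

∑-mono : (xs : List A) {f g : A → ℕ} → (∀ x → f x ≤ g x) → ∑ xs f ≤ ∑ xs g
∑-mono xs h = ∑-mono-∈ xs (λ {x} _ → h x)

∑-const : (xs : List A) (c : ℕ) → ∑ xs (λ _ → c) ≡ length xs * c
∑-const []       c = refl
∑-const (x ∷ xs) c = cong (c +_) (∑-const xs c)

∑-1 : (xs : List A) → ∑ xs (λ _ → 1) ≡ length xs
∑-1 xs = trans (∑-const xs 1) (*-identityʳ _)

∑-0 : (xs : List A) → ∑ xs (λ _ → 0) ≡ 0
∑-0 xs = trans (∑-const xs 0) (*-zeroʳ (length xs))

∑-+ : (xs : List A) (f g : A → ℕ) → ∑ xs (λ x → f x + g x) ≡ ∑ xs f + ∑ xs g
∑-+ []       f g = refl
∑-+ (x ∷ xs) f g = trans (cong ((f x + g x) +_) (∑-+ xs f g)) (interchange (f x) (g x) _ _)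
  where
  interchange : ∀ a b c d → (a + b) + (c + d) ≡ (a + c) + (b + d)
  interchange = solve-∀

*-∑ : (c : ℕ) (xs : List A) (f : A → ℕ) → c * ∑ xs f ≡ ∑ xs (λ x → c * f x)
*-∑ c []       f = *-zeroʳ c
*-∑ c (x ∷ xs) f = trans (*-distribˡ-+ c (f x) _) (cong (c * f x +_) (*-∑ c xs f))

∑-* : (xs : List A) (f : A → ℕ) (c : ℕ) → ∑ xs f * c ≡ ∑ xs (λ x → f x * c)
∑-* xs f c = trans (*-comm _ c) (trans (*-∑ c xs f) (∑-cong xs (λ x → *-comm c (f x))))

∑-swap : (xs : List A) (ys : List B) (f : A → B → ℕ) →
         ∑ xs (λ x → ∑ ys (f x)) ≡ ∑ ys (λ y → ∑ xs (λ x → f x y))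
∑-swap []       ys f = sym (∑-0 ys)
∑-swap (x ∷ xs) ys f =
  trans (cong (∑ ys (f x) +_) (∑-swap xs ys f)) (sym (∑-+ ys (f x) _))

∑-*-∑ : (xs : List A) (ys : List B) (f : A → ℕ) (g : B → ℕ) →
        ∑ xs f * ∑ ys g ≡ ∑ xs (λ x → ∑ ys (λ y → f x * g y))
∑-*-∑ xs ys f g = trans (∑-* xs f _) (∑-cong xs (λ x → *-∑ (f x) ys g))

∑-++ : (xs ys : List A) (f : A → ℕ) → ∑ (xs ++ ys) f ≡ ∑ xs f + ∑ ys f
∑-++ []       ys f = refl
∑-++ (x ∷ xs) ys f = trans (cong (f x +_) (∑-++ xs ys f)) (sym (+-assoc (f x) _ _))

∑-map : (h : A → B) (xs : List A) (f : B → ℕ) → ∑ (map h xs) f ≡ ∑ xs (f ∘ h)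
∑-map h []       f = refl
∑-map h (x ∷ xs) f = cong (f (h x) +_) (∑-map h xs f)

∑-cartesianProductWith : (h : A → B → C) (xs : List A) (ys : List B) (f : C → ℕ) →
  ∑ (cartesianProductWith h xs ys) f ≡ ∑ xs (λ x → ∑ ys (λ y → f (h x y)))
∑-cartesianProductWith h []       ys f = refl
∑-cartesianProductWith h (x ∷ xs) ys f =
  trans (∑-++ (map (h x) ys) _ f)
        (cong₂ _+_ (∑-map (h x) ys f) (∑-cartesianProductWith h xs ys f))

∈⇒≤∑ : {xs : List A} {x : A} (f : A → ℕ) → x ∈ xs → f x ≤ ∑ xs f
∈⇒≤∑ f (here refl) = m≤m+n _ _
∈⇒≤∑ f (there p)   = ≤-trans (∈⇒≤∑ f p) (m≤n+m _ _)

length-filter-∑ : {P : Pred A _} (P? : Decidable P) (xs : List A) →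
                  length (filter P? xs) ≡ ∑ xs (λ x → ⟦ P? x ⟧)
length-filter-∑ P? []       = refl
length-filter-∑ P? (x ∷ xs) with P? x
... | yes _ = cong suc (length-filter-∑ P? xs)
... | no  _ = length-filter-∑ P? xs

∑-⟦⟧-none : {P : Pred A _} (P? : Decidable P) (xs : List A) →
            (∀ {x} → x ∈ xs → ¬ P x) → ∑ xs (λ x → ⟦ P? x ⟧) ≡ 0
∑-⟦⟧-none P? []       ¬P = refl
∑-⟦⟧-none P? (x ∷ xs) ¬P with P? x
... | yes Px = contradiction Px (¬P (here refl))
... | no  _  = ∑-⟦⟧-none P? xs (¬P ∘ there)

-- Once one entry satisfies `P`, any later witness would equal it, which uniqueness of the list
-- forbids.
∑-⟦⟧≤1 : {P : Pred A _} (P? : Decidable P) {xs : List A} → Unique xs →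
         (∀ {x y} → P x → P y → x ≡ y) → ∑ xs (λ x → ⟦ P? x ⟧) ≤ 1
∑-⟦⟧≤1 P? {[]}     []          P-prop = z≤n
∑-⟦⟧≤1 P? {x ∷ xs} (x∉xs ∷ u) P-prop with P? x
... | no  _  = ∑-⟦⟧≤1 P? u P-prop
... | yes Px = s≤s (≤-reflexive (∑-⟦⟧-none P? xs λ y∈xs Py → All.lookup x∉xs y∈xs (P-prop Px Py)))

-- Induction on the list. Adding an entry a to a tail of length k with sum S and sum of squares Q
-- creates the cross term 2aS; summing 2ab ≤ a² + b² over the tail entries b bounds it by ka² + Q.
cauchy-schwarz : (xs : List A) (f : A → ℕ) →
                 ∑ xs f * ∑ xs f ≤ length xs * ∑ xs (λ x → f x * f x)
cauchy-schwarz []       f = z≤n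
cauchy-schwarz (x ∷ xs) f = begin
  (a + S) * (a + S)                   ≡⟨ square a S ⟩
  a * a + (S * S + 2 * (a * S))       ≤⟨ +-monoʳ-≤ (a * a) (+-mono-≤ (cauchy-schwarz xs f) cross) ⟩
  a * a + (k * Q + (k * (a * a) + Q)) ≡⟨ collect k (a * a) Q ⟩
  suc k * (a * a + Q)                 ∎
  where
  open ≤-Reasoning
  a = f x
  S = ∑ xs f
  Q = ∑ xs (λ y → f y * f y)
  k = length xs
  square : ∀ a s → (a + s) * (a + s) ≡ a * a + (s * s + 2 * (a * s))
  square = solve-∀
  collect : ∀ k a q → a + (k * q + (k * a + q)) ≡ suc k * (a + q)
  collect = solve-∀
  expand : ∀ m e → m * m + (m + e) * (m + e) ≡ 2 * (m * (m + e)) + e * e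
  expand = solve-∀
  -- Writing n = m + e makes the gap between the two sides exactly e², which avoids subtraction in
  -- ℕ.
  am-gm-≤ : ∀ {m n} → m ≤ n → 2 * (m * n) ≤ m * m + n * n
  am-gm-≤ {m} m≤n with m≤n⇒∃[o]m+o≡n m≤n
  ... | e , refl = ≤-trans (m≤m+n _ _) (≤-reflexive (sym (expand m e)))
  am-gm : ∀ m n → 2 * (m * n) ≤ m * m + n * n
  am-gm m n with ≤-total m n
  ... | inj₁ m≤n = am-gm-≤ m≤n
  ... | inj₂ n≤m = begin
    2 * (m * n)   ≡⟨ cong (2 *_) (*-comm m n) ⟩
    2 * (n * m)   ≤⟨ am-gm-≤ n≤m ⟩
    n * n + m * m ≡⟨ +-comm (n * n) _ ⟩
    m * m + n * n ∎
  cross : 2 * (a * S) ≤ k * (a * a) + Q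
  cross = begin
    2 * (a * S)                        ≡⟨ cong (2 *_) (*-∑ a xs f) ⟩
    2 * ∑ xs (λ y → a * f y)           ≡⟨ *-∑ 2 xs _ ⟩
    ∑ xs (λ y → 2 * (a * f y))         ≤⟨ ∑-mono xs (λ y → am-gm a (f y)) ⟩
    ∑ xs (λ y → a * a + f y * f y)     ≡⟨ ∑-+ xs _ _ ⟩
    ∑ xs (λ _ → a * a) + Q             ≡⟨ cong (_+ Q) (∑-const xs _) ⟩
    k * (a * a) + Q                    ∎

-- Comparing lengths through maps between lists

module _ (_≟_ : DecidableEquality A) where
  open DecMembership _≟_ using (_∈?_)

  -- Double counting of the pairs (x, y) with `h y ≡ x`: every x occurs in some pair, while a given
  -- y occurs in at most one because `xs` has no repetitions. Later `h` is often a scaling map, and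
  -- the right side counts the points that it carries into `xs`.
  length≤∑-preimage : {xs : List A} → Unique xs → (ys : List B) (h : B → A) →
    (∀ {x} → x ∈ xs → ∃ λ y → y ∈ ys × h y ≡ x) →
    length xs ≤ ∑ ys (λ y → ⟦ h y ∈? xs ⟧)
  length≤∑-preimage {xs = xs} u ys h onto = begin
    length xs                                   ≡⟨ ∑-1 xs ⟨
    ∑ xs (λ _ → 1)                              ≤⟨ ∑-mono-∈ xs hit ⟩
    ∑ xs (λ x → ∑ ys (λ y → ⟦ h y ≟ x ⟧))       ≡⟨ ∑-swap xs ys _ ⟩
    ∑ ys (λ y → ∑ xs (λ x → ⟦ h y ≟ x ⟧))       ≤⟨ ∑-mono ys (λ y → fibre (h y)) ⟩
    ∑ ys (λ y → ⟦ h y ∈? xs ⟧)                  ∎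
    where
    open ≤-Reasoning
    hit : ∀ {x} → x ∈ xs → 1 ≤ ∑ ys (λ y → ⟦ h y ≟ x ⟧)
    hit {x} x∈xs with onto x∈xs
    ... | y , y∈ys , hy≡x = ≤-trans (⟦⟧≥1 (h y ≟ x) hy≡x) (∈⇒≤∑ (λ y → ⟦ h y ≟ x ⟧) y∈ys)
    fibre : ∀ a → ∑ xs (λ x → ⟦ a ≟ x ⟧) ≤ ⟦ a ∈? xs ⟧
    fibre a with a ∈? xs
    ... | yes _    = ∑-⟦⟧≤1 (a ≟_) u (λ p q → trans (sym p) q)
    ... | no  a∉xs = ≤-reflexive (∑-⟦⟧-none (a ≟_) xs λ x∈xs a≡x → a∉xs (subst (_∈ xs) (sym a≡x) x∈xs))

  length-mono-⊆ : {xs ys : List A} → Unique xs → (∀ {x} → x ∈ xs → x ∈ ys) →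
                  length xs ≤ length ys
  length-mono-⊆ {xs} {ys} u xs⊆ys = begin
    length xs                 ≤⟨ length≤∑-preimage u ys id (λ {x} x∈xs → x , xs⊆ys x∈xs , refl) ⟩
    ∑ ys (λ y → ⟦ y ∈? xs ⟧)  ≤⟨ ∑-mono ys (λ y → ⟦⟧≤1 (y ∈? xs)) ⟩
    ∑ ys (λ _ → 1)            ≡⟨ ∑-1 ys ⟩
    length ys                 ∎
    where open ≤-Reasoning

-- Vector spaces over a finite field

module FieldLemmas {q : ℕ} (𝔽 : FiniteField q) where
  open FiniteField 𝔽 using (F; 0#; 1#; inverse; _≟_; enum; isCommutativeRing)
    renaming (_+_ to _⊕_; _*_ to _⊗_; -_ to ⊖_)

  commutativeRing : CommutativeRing _ _
  commutativeRing = record { isCommutativeRing = isCommutativeRing }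

  open CommutativeRing commutativeRing using (commutativeSemiring)
    renaming (*-assoc to ⊗-assoc; *-comm to ⊗-comm; *-identityˡ to ⊗-identityˡ;
              zeroʳ to ⊗-zeroʳ;
              +-identityʳ to ⊕-identityʳ; -‿inverseʳ to ⊖-inverseʳ; distribˡ to ⊗-distribˡ)
  open SemiringSolver commutativeSemiring using (solve; _:=_; _:+_; _:*_)

  ⊗-cancelˡ : ∀ {s x y} → s ≢ 0# → s ⊗ x ≡ s ⊗ y → x ≡ y
  ⊗-cancelˡ {s} {x} {y} s≢0 e with inverse s s≢0
  ... | i , si≡1 = trans (sym (undo x)) (trans (cong (i ⊗_) e) (undo y))
    where
    undo : ∀ z → i ⊗ (s ⊗ z) ≡ z
    undo z = trans (sym (⊗-assoc i s z))
               (trans (cong (_⊗ z) (trans (⊗-comm i s) si≡1)) (⊗-identityˡ z))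

  ⊗-cancelʳ : ∀ {s x y} → s ≢ 0# → x ⊗ s ≡ y ⊗ s → x ≡ y
  ⊗-cancelʳ s≢0 e = ⊗-cancelˡ s≢0 (trans (⊗-comm _ _) (trans e (⊗-comm _ _)))

  -- Both equations rearrange to (a - b)c = l - k, with c′ for c in the second, and a - b is
  -- invertible.
  affine-injective : ∀ {a b k l} → a ≢ b → ∀ {c c′} →
    a ⊗ c ⊕ k ≡ b ⊗ c ⊕ l → a ⊗ c′ ⊕ k ≡ b ⊗ c′ ⊕ l → c ≡ c′
  affine-injective {a} {b} {k} {l} a≢b e e′ =
    ⊗-cancelˡ a-b≢0 (trans (difference e) (sym (difference e′)))
    where
    open ≡-Reasoning
    difference : ∀ {c} → a ⊗ c ⊕ k ≡ b ⊗ c ⊕ l → (a ⊕ ⊖ b) ⊗ c ≡ l ⊕ ⊖ k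
    difference {c} e = begin
      -- The solver handles commutative semirings, so `⊖ b` and `⊖ k` enter it as independent atoms
      -- and their cancellations are separate steps.
      (a ⊕ ⊖ b) ⊗ c                        ≡⟨ ⊕-identityʳ _ ⟨
      (a ⊕ ⊖ b) ⊗ c ⊕ 0#                   ≡⟨ cong ((a ⊕ ⊖ b) ⊗ c ⊕_) (⊖-inverseʳ k) ⟨
      (a ⊕ ⊖ b) ⊗ c ⊕ (k ⊕ ⊖ k)            ≡⟨ solve 5 (λ a b c k k′ → (a :+ b) :* c :+ (k :+ k′) := (a :* c :+ k) :+ (b :* c :+ k′)) refl a (⊖ b) c k (⊖ k) ⟩
      (a ⊗ c ⊕ k) ⊕ (⊖ b ⊗ c ⊕ ⊖ k)        ≡⟨ cong (_⊕ (⊖ b ⊗ c ⊕ ⊖ k)) e ⟩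
      (b ⊗ c ⊕ l) ⊕ (⊖ b ⊗ c ⊕ ⊖ k)        ≡⟨ solve 5 (λ b b′ c l k′ → (b :* c :+ l) :+ (b′ :* c :+ k′) := (l :+ k′) :+ c :* (b :+ b′)) refl b (⊖ b) c l (⊖ k) ⟩
      (l ⊕ ⊖ k) ⊕ c ⊗ (b ⊕ ⊖ b)            ≡⟨ cong (λ z → (l ⊕ ⊖ k) ⊕ c ⊗ z) (⊖-inverseʳ b) ⟩
      (l ⊕ ⊖ k) ⊕ c ⊗ 0#                   ≡⟨ cong ((l ⊕ ⊖ k) ⊕_) (⊗-zeroʳ c) ⟩
      (l ⊕ ⊖ k) ⊕ 0#                       ≡⟨ ⊕-identityʳ _ ⟩
      l ⊕ ⊖ k                              ∎
    a-b≢0 : a ⊕ ⊖ b ≢ 0#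
    a-b≢0 z = a≢b (begin
      a                  ≡⟨ ⊕-identityʳ a ⟨
      a ⊕ 0#             ≡⟨ cong (a ⊕_) (⊖-inverseʳ b) ⟨
      a ⊕ (b ⊕ ⊖ b)      ≡⟨ solve 3 (λ a b b′ → a :+ (b :+ b′) := b :+ (a :+ b′)) refl a b (⊖ b) ⟩
      b ⊕ (a ⊕ ⊖ b)      ≡⟨ cong (b ⊕_) z ⟩
      b ⊕ 0#             ≡⟨ ⊕-identityʳ b ⟩
      b                  ∎)

  infixr 8 _·_
  _·_ : ∀ {d} → F → Vec F d → Vec F d
  s · x = Vec.map (s ⊗_) x

  ·-· : ∀ {d} s t (x : Vec F d) → s · (t · x) ≡ (s ⊗ t) · x
  ·-· s t Vec.[]       = refl
  ·-· s t (a Vec.∷ x) = cong₂ Vec._∷_ (sym (⊗-assoc s t a)) (·-· s t x)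

  1· : ∀ {d} (x : Vec F d) → 1# · x ≡ x
  1· Vec.[]       = refl
  1· (a Vec.∷ x) = cong₂ Vec._∷_ (⊗-identityˡ a) (1· x)

  dot-·ˡ : ∀ {d} s (x y : Vec F d) → dot 𝔽 (s · x) y ≡ s ⊗ dot 𝔽 x y
  dot-·ˡ s Vec.[]       Vec.[]       = sym (⊗-zeroʳ s)
  dot-·ˡ s (a Vec.∷ x) (b Vec.∷ y) =
    trans (cong₂ _⊕_ (⊗-assoc s a b) (dot-·ˡ s x y)) (sym (⊗-distribˡ s (a ⊗ b) _))

  dot-comm : ∀ {d} (x y : Vec F d) → dot 𝔽 x y ≡ dot 𝔽 y x
  dot-comm Vec.[]       Vec.[]       = refl
  dot-comm (a Vec.∷ x) (b Vec.∷ y) = cong₂ _⊕_ (⊗-comm a b) (dot-comm x y)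

  dot-·ʳ : ∀ {d} s (x y : Vec F d) → dot 𝔽 x (s · y) ≡ s ⊗ dot 𝔽 x y
  dot-·ʳ s x y = trans (dot-comm x (s · y)) (trans (dot-·ˡ s y x) (cong (s ⊗_) (dot-comm y x)))

  -- Enumeration of the space and the size of a hyperplane

  scalars : List F
  scalars = tabulate (Inverse.from enum)

  length-scalars : length scalars ≡ q
  length-scalars = length-tabulate (Inverse.from enum)

  scalars-unique : Unique scalars
  scalars-unique = Unique-tabulate⁺ λ {i} {j} e →
    trans (sym (Inverse.inverseˡ enum refl)) (trans (cong (Inverse.to enum) e) (Inverse.inverseˡ enum refl))

  ∈-scalars : ∀ x → x ∈ scalars
  ∈-scalars x = subst (_∈ scalars) (Inverse.inverseʳ enum refl) (∈-tabulate⁺ (Inverse.to enum x))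

  vectors : ∀ d → List (Vec F d)
  vectors zero    = Vec.[] ∷ []
  vectors (suc d) = cartesianProductWith Vec._∷_ scalars (vectors d)

  ∈-vectors : ∀ {d} (x : Vec F d) → x ∈ vectors d
  ∈-vectors Vec.[]       = here refl
  ∈-vectors (a Vec.∷ x) = ∈-cartesianProductWith⁺ Vec._∷_ (∈-scalars a) (∈-vectors x)

  ∑-scalars-const : ∀ c → ∑ scalars (λ _ → c) ≡ q * c
  ∑-scalars-const c = trans (∑-const scalars c) (cong (_* c) length-scalars)

  length-vectors : ∀ d → length (vectors d) ≡ q ^ d
  length-vectors zero    = refl
  length-vectors (suc d) = begin
    length (vectors (suc d))                                 ≡⟨ ∑-1 (vectors (suc d)) ⟨
    ∑ (vectors (suc d)) (λ _ → 1)                            ≡⟨ ∑-cartesianProductWith Vec._∷_ scalars (vectors d) _ ⟩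
    ∑ scalars (λ _ → ∑ (vectors d) (λ _ → 1))                ≡⟨ ∑-scalars-const _ ⟩
    q * ∑ (vectors d) (λ _ → 1)                              ≡⟨ cong (q *_) (trans (∑-1 (vectors d)) (length-vectors d)) ⟩
    q * q ^ d                                                ∎
    where open ≡-Reasoning

  -- The offsets `s` and `t` make the induction on the dimension go through. If the tails differ,
  -- fixing the first coordinate c leaves an equation of the same shape, with `a ⊗ c` and `b ⊗ c`
  -- absorbed into the offsets. If the tails agree, then a ≢ b, and each choice of the other
  -- coordinates admits at most one c.
  hyperplane-≤ : ∀ {d} (u v : Vec F d) → u ≢ v → ∀ s t →
    q * ∑ (vectors d) (λ w → ⟦ (dot 𝔽 u w ⊕ s) ≟ (dot 𝔽 v w ⊕ t) ⟧) ≤ q ^ d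
  hyperplane-≤ Vec.[] Vec.[] u≢v s t = contradiction refl u≢v
  hyperplane-≤ {suc d} (a Vec.∷ u) (b Vec.∷ v) u≢v s t with vecDec 𝔽 u v
  ... | no u≢v′ = begin
    q * ∑ (vectors (suc d)) G                                ≡⟨ cong (q *_) (∑-cartesianProductWith Vec._∷_ scalars (vectors d) G) ⟩
    q * ∑ scalars (λ c → ∑ (vectors d) (λ w → G (c Vec.∷ w))) ≡⟨ *-∑ q scalars _ ⟩
    ∑ scalars (λ c → q * ∑ (vectors d) (λ w → G (c Vec.∷ w))) ≤⟨ ∑-mono scalars (λ c → *-monoʳ-≤ q (∑-mono (vectors d) (λ w → shift c w))) ⟩
    ∑ scalars (λ c → q * ∑ (vectors d) (λ w → ⟦ (dot 𝔽 u w ⊕ (a ⊗ c ⊕ s)) ≟ (dot 𝔽 v w ⊕ (b ⊗ c ⊕ t)) ⟧))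
                                                             ≤⟨ ∑-mono scalars (λ c → hyperplane-≤ u v u≢v′ _ _) ⟩
    ∑ scalars (λ _ → q ^ d)                                  ≡⟨ ∑-scalars-const _ ⟩
    q * q ^ d                                                ∎
    where
    open ≤-Reasoning
    G : Vec F (suc d) → ℕ
    G w = ⟦ (dot 𝔽 (a Vec.∷ u) w ⊕ s) ≟ (dot 𝔽 (b Vec.∷ v) w ⊕ t) ⟧
    rotate : ∀ x y z → (x ⊕ y) ⊕ z ≡ y ⊕ (x ⊕ z)
    rotate = solve 3 (λ x y z → (x :+ y) :+ z := y :+ (x :+ z)) refl
    shift : ∀ c w → G (c Vec.∷ w) ≤ ⟦ (dot 𝔽 u w ⊕ (a ⊗ c ⊕ s)) ≟ (dot 𝔽 v w ⊕ (b ⊗ c ⊕ t)) ⟧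
    shift c w = ⟦⟧-mono (_ ≟ _) (_ ≟ _) λ e → trans (sym (rotate _ _ _)) (trans e (rotate _ _ _))
  ... | yes refl = begin
    q * ∑ (vectors (suc d)) G                                ≡⟨ cong (q *_) (∑-cartesianProductWith Vec._∷_ scalars (vectors d) G) ⟩
    q * ∑ scalars (λ c → ∑ (vectors d) (λ w → G (c Vec.∷ w))) ≡⟨ cong (q *_) (∑-swap scalars (vectors d) _) ⟩
    q * ∑ (vectors d) (λ w → ∑ scalars (λ c → G (c Vec.∷ w))) ≤⟨ *-monoʳ-≤ q (∑-mono (vectors d) one) ⟩
    q * ∑ (vectors d) (λ _ → 1)                              ≡⟨ cong (q *_) (trans (∑-1 (vectors d)) (length-vectors d)) ⟩
    q * q ^ d                                                ∎
    where
    open ≤-Reasoning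
    G : Vec F (suc d) → ℕ
    G w = ⟦ (dot 𝔽 (a Vec.∷ u) w ⊕ s) ≟ (dot 𝔽 (b Vec.∷ u) w ⊕ t) ⟧
    a≢b : a ≢ b
    a≢b e = u≢v (cong (Vec._∷ u) e)
    assoc : ∀ x y z → (x ⊕ y) ⊕ z ≡ x ⊕ (y ⊕ z)
    assoc = solve 3 (λ x y z → (x :+ y) :+ z := x :+ (y :+ z)) refl
    reassoc : ∀ {x y z x′ y′ z′} → (x ⊕ y) ⊕ z ≡ (x′ ⊕ y′) ⊕ z′ → x ⊕ (y ⊕ z) ≡ x′ ⊕ (y′ ⊕ z′)
    reassoc e = trans (sym (assoc _ _ _)) (trans e (assoc _ _ _))
    one : ∀ w → ∑ scalars (λ c → G (c Vec.∷ w)) ≤ 1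
    one w = ∑-⟦⟧≤1 (λ c → _ ≟ _) scalars-unique
              (λ e e′ → affine-injective a≢b (reassoc e) (reassoc e′))

-- Collisions among the dot products with a fixed vector

module Pinned {r : ℕ} (𝔽 : FiniteField (suc r)) {d : ℕ}
  (E : List (Vec (FiniteField.F 𝔽) d)) (E-unique : Unique E)
  -- The size hypothesis |E| ≥ q^((d+1)/2) is squared to keep the exponent integral. Writing q as
  -- `suc r` lets `r` stand for q - 1.
  (large : suc r ^ suc d ≤ length E * length E) where

  open FiniteField 𝔽 using (F; 0#; inverse; _≟_) renaming (_+_ to _⊕_; _*_ to _⊗_)
  open FieldLemmas 𝔽
  open CommutativeRing commutativeRing using ()
    renaming (*-assoc to ⊗-assoc; *-comm to ⊗-comm; *-identityʳ to ⊗-identityʳ)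

  private
    q = suc r
    n = length E
    V = vectors d
    _≟ᵥ_ = vecDec 𝔽 {d}
    open DecMembership _≟ᵥ_ using (_∈?_)

  instance
    n-nonZero : NonZero n
    n-nonZero = ≢-nonZero λ n≡0 →
      <⇒≱ (m^n>0 q (suc d)) (subst (λ m → q ^ suc d ≤ m * m) n≡0 large)

  -- The length of this list is `projCard 𝔽 y E` by definition.
  projection : Vec F d → List F
  projection y = deduplicate _≟_ (map (λ x → dot 𝔽 x y) E)

  dot∈projection : ∀ {x} y → x ∈ E → dot 𝔽 x y ∈ projection y
  dot∈projection y x∈E = ∈-deduplicate⁺ _≟_ (∈-map⁺ (λ x → dot 𝔽 x y) x∈E)

  projection-unique : ∀ y → Unique (projection y)
  projection-unique y = deduplicate-! _≟_ (map (λ x → dot 𝔽 x y) E)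

  -- The quantity K(y): the sum of the squared fibre sizes of x ↦ x · y on E.
  collisions : Vec F d → ℕ
  collisions y = ∑ E (λ x → ∑ E (λ x′ → ⟦ dot 𝔽 x y ≟ dot 𝔽 x′ y ⟧))

  -- With the sum over y innermost, and after multiplication by q, an off-diagonal pair contributes
  -- at most q^d by `hyperplane-≤`. One of the n diagonal pairs contributes q · q^d, an extra
  -- `r * q ^ d`.
  ∑-collisions-≤ : q * ∑ V collisions ≤ n * (n * q ^ d + r * q ^ d)
  ∑-collisions-≤ = begin
    q * ∑ V collisions
      ≡⟨ cong (q *_) (∑-swap V E _) ⟩
    q * ∑ E (λ x → ∑ V (λ y → ∑ E (λ x′ → ⟦ dot 𝔽 x y ≟ dot 𝔽 x′ y ⟧)))
      ≡⟨ cong (q *_) (∑-cong E (λ x → ∑-swap V E _)) ⟩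
    q * ∑ E (λ x → ∑ E (Z x))
      ≡⟨ *-∑ q E _ ⟩
    ∑ E (λ x → q * ∑ E (Z x))
      ≤⟨ ∑-mono E row ⟩
    ∑ E (λ _ → n * q ^ d + r * q ^ d)
      ≡⟨ ∑-const E _ ⟩
    n * (n * q ^ d + r * q ^ d) ∎
    where
    open ≤-Reasoning
    Z : Vec F d → Vec F d → ℕ
    Z x x′ = ∑ V (λ y → ⟦ dot 𝔽 x y ≟ dot 𝔽 x′ y ⟧)
    entry : ∀ x x′ → q * Z x x′ ≤ q ^ d + ⟦ x ≟ᵥ x′ ⟧ * (r * q ^ d)
    entry x x′ with x ≟ᵥ x′
    ... | yes _ = begin
      q * Z x x′                ≤⟨ *-monoʳ-≤ q (∑-mono V (λ y → ⟦⟧≤1 (dot 𝔽 x y ≟ dot 𝔽 x′ y))) ⟩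
      q * ∑ V (λ _ → 1)         ≡⟨ cong (q *_) (trans (∑-1 V) (length-vectors d)) ⟩
      q ^ d + r * q ^ d         ≡⟨ cong (q ^ d +_) (*-identityˡ _) ⟨
      q ^ d + 1 * (r * q ^ d)   ∎
    ... | no x≢x′ = begin
      q * Z x x′                ≤⟨ *-monoʳ-≤ q (∑-mono V (λ y → ⟦⟧-mono (_ ≟ _) (_ ≟ _) (cong (_⊕ 0#)))) ⟩
      q * ∑ V (λ y → ⟦ (dot 𝔽 x y ⊕ 0#) ≟ (dot 𝔽 x′ y ⊕ 0#) ⟧) ≤⟨ hyperplane-≤ x x′ x≢x′ 0# 0# ⟩
      q ^ d                     ≡⟨ +-identityʳ _ ⟨
      q ^ d + 0                 ∎
    row : ∀ x → q * ∑ E (Z x) ≤ n * q ^ d + r * q ^ d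
    row x = begin
      q * ∑ E (Z x)                                             ≡⟨ *-∑ q E _ ⟩
      ∑ E (λ x′ → q * Z x x′)                                   ≤⟨ ∑-mono E (entry x) ⟩
      ∑ E (λ x′ → q ^ d + ⟦ x ≟ᵥ x′ ⟧ * (r * q ^ d))            ≡⟨ ∑-+ E _ _ ⟩
      ∑ E (λ _ → q ^ d) + ∑ E (λ x′ → ⟦ x ≟ᵥ x′ ⟧ * (r * q ^ d)) ≡⟨ cong₂ _+_ (∑-const E _) (sym (∑-* E _ _)) ⟩
      n * q ^ d + ∑ E (λ x′ → ⟦ x ≟ᵥ x′ ⟧) * (r * q ^ d)        ≤⟨ +-monoʳ-≤ (n * q ^ d) (*-monoˡ-≤ (r * q ^ d) (∑-⟦⟧≤1 (x ≟ᵥ_) E-unique (λ e e′ → trans (sym e) e′))) ⟩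
      n * q ^ d + 1 * (r * q ^ d)                               ≡⟨ cong (n * q ^ d +_) (*-identityˡ _) ⟩
      n * q ^ d + r * q ^ d                                     ∎

  -- Cauchy-Schwarz for the fibre sizes ν over the projection: they add up to at least n, and their
  -- squares add up to at most K(y), since a pair of points shares at most one value t.
  n²≤projCard*collisions : ∀ y → n * n ≤ projCard 𝔽 y E * collisions y
  n²≤projCard*collisions y = begin
    n * n                                       ≤⟨ *-mono-≤ n≤∑ν n≤∑ν ⟩
    ∑ T ν * ∑ T ν                               ≤⟨ cauchy-schwarz T ν ⟩
    length T * ∑ T (λ t → ν t * ν t)            ≤⟨ *-monoʳ-≤ (length T) ∑ν²≤ ⟩
    length T * collisions y                     ∎
    where
    open ≤-Reasoning
    T = projection y
    δ : Vec F d → F → ℕ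
    δ x t = ⟦ dot 𝔽 x y ≟ t ⟧
    ν : F → ℕ
    ν t = ∑ E (λ x → δ x t)
    n≤∑ν : n ≤ ∑ T ν
    n≤∑ν = begin
      n                         ≡⟨ ∑-1 E ⟨
      ∑ E (λ _ → 1)             ≤⟨ ∑-mono-∈ E (λ {x} x∈E → ≤-trans (⟦⟧≥1 (dot 𝔽 x y ≟ _) refl) (∈⇒≤∑ (δ x) (dot∈projection y x∈E))) ⟩
      ∑ E (λ x → ∑ T (δ x))     ≡⟨ ∑-swap E T δ ⟩
      ∑ T ν                     ∎
    same : ∀ x x′ → ∑ T (λ t → δ x t * δ x′ t) ≤ ⟦ dot 𝔽 x y ≟ dot 𝔽 x′ y ⟧
    same x x′ with dot 𝔽 x y ≟ dot 𝔽 x′ y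
    ... | yes _ = begin
      ∑ T (λ t → δ x t * δ x′ t)  ≤⟨ ∑-mono T (λ t → *-monoʳ-≤ (δ x t) (⟦⟧≤1 (dot 𝔽 x′ y ≟ t))) ⟩
      ∑ T (λ t → δ x t * 1)       ≡⟨ ∑-cong T (λ t → *-identityʳ (δ x t)) ⟩
      ∑ T (δ x)                   ≤⟨ ∑-⟦⟧≤1 (dot 𝔽 x y ≟_) (projection-unique y) (λ e e′ → trans (sym e) e′) ⟩
      1                           ∎
    ... | no x·y≢x′·y = begin
      ∑ T (λ t → δ x t * δ x′ t)  ≤⟨ ∑-mono T disjoint ⟩
      ∑ T (λ _ → 0)               ≡⟨ ∑-0 T ⟩
      0                           ∎
      where
      disjoint : ∀ t → δ x t * δ x′ t ≤ 0
      disjoint t with dot 𝔽 x y ≟ t | dot 𝔽 x′ y ≟ t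
      ... | yes e | yes e′ = contradiction (trans e (sym e′)) x·y≢x′·y
      ... | yes _ | no _   = z≤n
      ... | no  _ | _      = z≤n
    ∑ν²≤ : ∑ T (λ t → ν t * ν t) ≤ collisions y
    ∑ν²≤ = begin
      ∑ T (λ t → ν t * ν t)                                     ≡⟨ ∑-cong T (λ t → ∑-*-∑ E E _ _) ⟩
      ∑ T (λ t → ∑ E (λ x → ∑ E (λ x′ → δ x t * δ x′ t)))       ≡⟨ ∑-swap T E _ ⟩
      ∑ E (λ x → ∑ T (λ t → ∑ E (λ x′ → δ x t * δ x′ t)))       ≡⟨ ∑-cong E (λ x → ∑-swap T E _) ⟩
      ∑ E (λ x → ∑ E (λ x′ → ∑ T (λ t → δ x t * δ x′ t)))       ≤⟨ ∑-mono E (λ x → ∑-mono E (same x)) ⟩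
      collisions y                                              ∎

  n²≤q*collisions : ∀ y → n * n ≤ q * collisions y
  n²≤q*collisions y = ≤-trans (n²≤projCard*collisions y) (*-monoˡ-≤ (collisions y)
    (subst (projCard 𝔽 y E ≤_) length-scalars
      (length-mono-⊆ _≟_ (projection-unique y) (λ {t} _ → ∈-scalars t))))

  -- Good and bad vectors, and a bound for the bad ones

  Good Bad : Vec F d → Set
  Good y = q < 2 * projCard 𝔽 y E
  Bad y  = ¬ Good y

  good? : Decidable Good
  good? y = q <? 2 * projCard 𝔽 y E

  bad? : Decidable Bad
  bad? y = ¬? (good? y)

  -- `#good` ranges over E only, whereas `#bad` ranges over the whole space, which is where the sum
  -- of K is controlled.
  #good #bad : ℕ
  #good = length (filter good? E)
  #bad  = ∑ V (λ y → ⟦ bad? y ⟧)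

  -- Every y satisfies n² ≤ qK(y), and `m` measures the surplus guaranteed at bad y. Summing over
  -- the space, the main term q^d n² cancels and leaves `#bad * m * n²` at most n r q^d; `large`
  -- then turns q · q^d into n². It is applied with m = 1 and, for large q, with m = 2.
  #bad-≤ : ∀ m → (∀ y → Bad y → suc m * (n * n) ≤ q * collisions y) → q * (#bad * m) ≤ r * n
  #bad-≤ m bad-large = *-cancelʳ-≤ _ _ (n * n) {{m*n≢0 n n}} (begin
    q * (#bad * m) * (n * n)      ≡⟨ reorder q #bad m (n * n) ⟩
    q * (#bad * (m * (n * n)))    ≤⟨ *-monoʳ-≤ q excess ⟩
    q * (n * (r * q ^ d))         ≡⟨ regroup q n r (q ^ d) ⟩
    r * n * (q * q ^ d)           ≤⟨ *-monoʳ-≤ (r * n) large ⟩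
    r * n * (n * n)               ∎)
    where
    open ≤-Reasoning
    reorder : ∀ q b m s → q * (b * m) * s ≡ q * (b * (m * s))
    reorder = solve-∀
    regroup : ∀ q n r Q → q * (n * (r * Q)) ≡ r * n * (q * Q)
    regroup = solve-∀
    split : ∀ n Q R → n * (n * Q + R) ≡ Q * (n * n) + n * R
    split = solve-∀
    pointwise : ∀ y → n * n + ⟦ bad? y ⟧ * (m * (n * n)) ≤ q * collisions y
    pointwise y with bad? y
    ... | yes bad-y = ≤-trans (≤-reflexive (cong (n * n +_) (*-identityˡ _))) (bad-large y bad-y)
    ... | no  _     = ≤-trans (≤-reflexive (+-identityʳ _)) (n²≤q*collisions y)
    excess : #bad * (m * (n * n)) ≤ n * (r * q ^ d)
    excess = +-cancelˡ-≤ (q ^ d * (n * n)) _ _ (begin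
      q ^ d * (n * n) + #bad * (m * (n * n))
        ≡⟨ cong₂ _+_ (sym (trans (∑-const V _) (cong (_* (n * n)) (length-vectors d)))) (∑-* V _ _) ⟩
      ∑ V (λ _ → n * n) + ∑ V (λ y → ⟦ bad? y ⟧ * (m * (n * n)))
        ≡⟨ ∑-+ V _ _ ⟨
      ∑ V (λ y → n * n + ⟦ bad? y ⟧ * (m * (n * n)))
        ≤⟨ ∑-mono V pointwise ⟩
      ∑ V (λ y → q * collisions y)
        ≡⟨ *-∑ q V _ ⟨
      q * ∑ V collisions
        ≤⟨ ∑-collisions-≤ ⟩
      n * (n * q ^ d + r * q ^ d)
        ≡⟨ split n (q ^ d) (r * q ^ d) ⟩
      q ^ d * (n * n) + n * (r * q ^ d) ∎)

  q*#bad≤r*n : q * #bad ≤ r * n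
  q*#bad≤r*n = subst (λ b → q * b ≤ r * n) (*-identityʳ #bad) (#bad-≤ 1 λ y bad-y → begin
    2 * (n * n)                            ≤⟨ *-monoʳ-≤ 2 (n²≤projCard*collisions y) ⟩
    2 * (projCard 𝔽 y E * collisions y)    ≡⟨ *-assoc 2 (projCard 𝔽 y E) _ ⟨
    2 * projCard 𝔽 y E * collisions y      ≤⟨ *-monoˡ-≤ (collisions y) (≮⇒≥ bad-y) ⟩
    q * collisions y                       ∎)
    where open ≤-Reasoning

  n≤#good+#bad : n ≤ #good + #bad
  n≤#good+#bad = begin
    n                                                     ≡⟨ ∑-1 E ⟨
    ∑ E (λ _ → 1)                                         ≤⟨ ∑-mono E dichotomy ⟩
    ∑ E (λ x → ⟦ good? x ⟧ + ⟦ bad? x ⟧)                  ≡⟨ ∑-+ E _ _ ⟩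
    ∑ E (λ x → ⟦ good? x ⟧) + ∑ E (λ x → ⟦ bad? x ⟧)      ≡⟨ cong₂ _+_ (length-filter-∑ good? E) (length-filter-∑ bad? E) ⟨
    #good + length (filter bad? E)                        ≤⟨ +-monoʳ-≤ #good (length≤∑-preimage _≟ᵥ_ (Unique-filter⁺ bad? E-unique) V id (λ {x} _ → x , ∈-vectors x , refl)) ⟩
    #good + ∑ V (λ y → ⟦ y ∈? filter bad? E ⟧)            ≤⟨ +-monoʳ-≤ #good (∑-mono V (λ y → ⟦⟧-mono (y ∈? filter bad? E) (bad? y) (proj₂ ∘ ∈-filter⁻ bad? {xs = E}))) ⟩
    #good + #bad                                          ∎
    where
    open ≤-Reasoning
    dichotomy : ∀ x → 1 ≤ ⟦ good? x ⟧ + ⟦ bad? x ⟧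
    dichotomy x with good? x
    ... | yes _ = ≤-refl
    ... | no  _ = ≤-refl

  n≤q*#good : n ≤ q * #good
  -- `q * n` unfolds to `n + r * n`, so cancelling `r * n` leaves n on the left.
  n≤q*#good = +-cancelʳ-≤ (r * n) _ _ (begin
    q * n                    ≤⟨ *-monoʳ-≤ q n≤#good+#bad ⟩
    q * (#good + #bad)       ≡⟨ *-distribˡ-+ q #good #bad ⟩
    q * #good + q * #bad     ≤⟨ +-monoʳ-≤ (q * #good) q*#bad≤r*n ⟩
    q * #good + r * n        ∎)
    where open ≤-Reasoning

  -- Scaling, and points with many multiples in E

  -- Multiplication by s injects the values x · y into the values x · (sy).
  projCard-· : ∀ {s} → s ≢ 0# → ∀ y → projCard 𝔽 y E ≤ projCard 𝔽 (s · y) E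
  projCard-· {s} s≢0 y = begin
    length (projection y)                ≡⟨ length-map (s ⊗_) (projection y) ⟨
    length (map (s ⊗_) (projection y))   ≤⟨ length-mono-⊆ _≟_ (Unique-map⁺ (⊗-cancelˡ s≢0) (projection-unique y)) scaled ⟩
    length (projection (s · y))          ∎
    where
    open ≤-Reasoning
    scaled : ∀ {t} → t ∈ map (s ⊗_) (projection y) → t ∈ projection (s · y)
    scaled t∈ with ∈-map⁻ (s ⊗_) t∈
    ... | u , u∈ , refl with ∈-map⁻ (λ x → dot 𝔽 x y) (∈-deduplicate⁻ _≟_ (map (λ x → dot 𝔽 x y) E) u∈)
    ...   | x , x∈E , refl = subst (_∈ projection (s · y)) (dot-·ʳ s x y) (dot∈projection (s · y) x∈E)

  Bad-· : ∀ {s y} → s ≢ 0# → Bad (s · y) → Bad y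
  Bad-· {y = y} s≢0 bad good = bad (≤-trans good (*-monoʳ-≤ 2 (projCard-· s≢0 y)))

  -- Scalars are counted rather than distinct vectors, and s = 0 is included; so the zero vector, if
  -- it lies in E, has q multiples and is rich.
  multiples : Vec F d → ℕ
  multiples x = ∑ scalars (λ s → ⟦ (s · x) ∈? E ⟧)

  Rich : Vec F d → Set
  Rich x = q < 2 * multiples x

  rich? : Decidable Rich
  rich? x = q <? 2 * multiples x

  -- If x · y were nonzero, s ↦ s(x · y) would be injective. On the more than q/2 scalars with sx in
  -- E it takes values in the projection along y, which would make y good.
  rich⊥bad : ∀ {x y} → Rich x → Bad y → dot 𝔽 x y ≡ 0#
  rich⊥bad {x} {y} rich bad with dot 𝔽 x y ≟ 0#
  ... | yes x·y≡0 = x·y≡0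
  ... | no  x·y≢0 = ⊥-elim (bad (≤-trans rich (*-monoʳ-≤ 2 (begin
    multiples x                               ≡⟨ length-filter-∑ on-line? scalars ⟨
    length S                                  ≡⟨ length-map (_⊗ dot 𝔽 x y) S ⟨
    length (map (_⊗ dot 𝔽 x y) S)             ≤⟨ length-mono-⊆ _≟_ (Unique-map⁺ (⊗-cancelʳ x·y≢0) (Unique-filter⁺ on-line? scalars-unique)) values ⟩
    projCard 𝔽 y E                            ∎))))
    where
    open ≤-Reasoning
    on-line? : Decidable (λ s → (s · x) ∈ E)
    on-line? s = (s · x) ∈? E
    S = filter on-line? scalars
    values : ∀ {t} → t ∈ map (_⊗ dot 𝔽 x y) S → t ∈ projection y
    values t∈ with ∈-map⁻ (_⊗ dot 𝔽 x y) t∈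
    ... | s , s∈S , refl = subst (_∈ projection y) (dot-·ˡ s x y)
                             (dot∈projection y (proj₂ (∈-filter⁻ on-line? {xs = scalars} s∈S)))

  #rich : ℕ
  #rich = ∑ E (λ x → ⟦ rich? x ⟧)

  -- Rich points all have dot product 0 with a bad y, so any two of them collide.
  #rich²≤collisions : ∀ y → Bad y → #rich * #rich ≤ collisions y
  #rich²≤collisions y bad = begin
    #rich * #rich                                              ≡⟨ ∑-*-∑ E E _ _ ⟩
    ∑ E (λ x → ∑ E (λ x′ → ⟦ rich? x ⟧ * ⟦ rich? x′ ⟧))        ≤⟨ ∑-mono E (λ x → ∑-mono E (both x)) ⟩
    collisions y                                               ∎
    where
    open ≤-Reasoning
    both : ∀ x x′ → ⟦ rich? x ⟧ * ⟦ rich? x′ ⟧ ≤ ⟦ dot 𝔽 x y ≟ dot 𝔽 x′ y ⟧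
    both x x′ with rich? x | rich? x′
    ... | yes p | yes p′ = ⟦⟧≥1 (dot 𝔽 x y ≟ dot 𝔽 x′ y) (trans (rich⊥bad p bad) (sym (rich⊥bad p′ bad)))
    ... | yes _ | no  _  = z≤n
    ... | no  _ | _      = z≤n

  -- Bad points of E that are not rich

  poor-bad? : Decidable (λ x → Bad x × ¬ Rich x)
  poor-bad? x = bad? x ×-dec ¬? (rich? x)

  poor-bad : List (Vec F d)
  poor-bad = filter poor-bad? E

  nonzero? : Decidable (_≢ 0#)
  nonzero? s = ¬? (s ≟ 0#)

  units : List F
  units = filter nonzero? scalars

  r≤#units : r ≤ length units
  r≤#units = +-cancelʳ-≤ 1 _ _ (begin
    r + 1                                                          ≡⟨ +-comm r 1 ⟩
    q                                                              ≡⟨ trans (∑-1 scalars) length-scalars ⟨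
    ∑ scalars (λ _ → 1)                                            ≤⟨ ∑-mono scalars dichotomy ⟩
    ∑ scalars (λ s → ⟦ nonzero? s ⟧ + ⟦ s ≟ 0# ⟧)                  ≡⟨ ∑-+ scalars (λ s → ⟦ nonzero? s ⟧) (λ s → ⟦ s ≟ 0# ⟧) ⟩
    ∑ scalars (λ s → ⟦ nonzero? s ⟧) + ∑ scalars (λ s → ⟦ s ≟ 0# ⟧) ≤⟨ +-mono-≤ (≤-reflexive (sym (length-filter-∑ nonzero? scalars))) (∑-⟦⟧≤1 (_≟ 0#) scalars-unique (λ e e′ → trans e (sym e′))) ⟩
    length units + 1                                               ∎)
    where
    open ≤-Reasoning
    dichotomy : ∀ s → 1 ≤ ⟦ nonzero? s ⟧ + ⟦ s ≟ 0# ⟧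
    dichotomy s with s ≟ 0#
    ... | yes _ = ≤-refl
    ... | no  _ = ≤-refl

  -- A single unit s₀ with s₀z in `poor-bad` settles both factors on the right: z is bad by scaling,
  -- and every sz is the multiple s/s₀ of s₀z, which has at most q/2 multiples in E. If there is no
  -- such s₀, the left side is 0.
  poor-multiples-≤ : ∀ z → 2 * ∑ units (λ s → ⟦ (s · z) ∈? poor-bad ⟧) ≤ ⟦ bad? z ⟧ * q
  poor-multiples-≤ z with any? (λ s → (s · z) ∈? poor-bad) units
  ... | no none = ≤-trans (≤-reflexive (cong (2 *_) (∑-⟦⟧-none (λ s → (s · z) ∈? poor-bad) units (λ s∈ p → none (lose s∈ p))))) z≤n
  ... | yes some with find some
  ...   | s₀ , s₀∈units , s₀z∈poor = begin
    2 * ∑ units (λ s → ⟦ poor? s ⟧)               ≡⟨ cong (2 *_) (length-filter-∑ poor? units) ⟨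
    2 * length S                                  ≤⟨ *-monoʳ-≤ 2 (length≤∑-preimage _≟_ (Unique-filter⁺ poor? (Unique-filter⁺ nonzero? scalars-unique)) scalars (_⊗ s₀) (λ {s} _ → s ⊗ i , ∈-scalars _ , divide s)) ⟩
    2 * ∑ scalars (λ u → ⟦ (u ⊗ s₀) ∈ꟳ? S ⟧)      ≤⟨ *-monoʳ-≤ 2 (∑-mono scalars (λ u → ⟦⟧-mono ((u ⊗ s₀) ∈ꟳ? S) ((u · (s₀ · z)) ∈? E) (on-line u))) ⟩
    2 * multiples (s₀ · z)                        ≤⟨ ≮⇒≥ (proj₂ s₀z-props) ⟩
    q                                             ≡⟨ *-identityˡ q ⟨
    1 * q                                         ≤⟨ *-monoˡ-≤ q (⟦⟧≥1 (bad? z) (Bad-· s₀≢0 (proj₁ s₀z-props))) ⟩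
    ⟦ bad? z ⟧ * q                                ∎
    where
    open ≤-Reasoning
    open DecMembership _≟_ using () renaming (_∈?_ to _∈ꟳ?_)
    poor? : Decidable (λ s → (s · z) ∈ poor-bad)
    poor? s = (s · z) ∈? poor-bad
    S = filter poor? units
    s₀≢0 : s₀ ≢ 0#
    s₀≢0 = proj₂ (∈-filter⁻ nonzero? {xs = scalars} s₀∈units)
    s₀z-props : Bad (s₀ · z) × ¬ Rich (s₀ · z)
    s₀z-props = proj₂ (∈-filter⁻ poor-bad? {xs = E} s₀z∈poor)
    i = proj₁ (inverse s₀ s₀≢0)
    divide : ∀ s → (s ⊗ i) ⊗ s₀ ≡ s
    divide s = trans (⊗-assoc s i s₀)
      (trans (cong (s ⊗_) (trans (⊗-comm i s₀) (proj₂ (inverse s₀ s₀≢0)))) (⊗-identityʳ s))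
    on-line : ∀ u → (u ⊗ s₀) ∈ S → (u · (s₀ · z)) ∈ E
    on-line u us₀∈S = subst (_∈ E) (sym (·-· u s₀ z))
      (proj₁ (∈-filter⁻ poor-bad? {xs = E} (proj₂ (∈-filter⁻ poor? {xs = units} us₀∈S))))

  -- Count the pairs (s, z) with s a unit and sz in `poor-bad`. Each s yields at least
  -- `length poor-bad` of them, because scaling by s is onto; each z yields at most q/2, and none
  -- unless z is bad. The bound on `#bad` finishes the estimate.
  r*2*#poor-bad≤r*n : r * (2 * length poor-bad) ≤ r * n
  r*2*#poor-bad≤r*n = begin
    r * (2 * p)                                                   ≤⟨ *-monoˡ-≤ (2 * p) r≤#units ⟩
    length units * (2 * p)                                        ≡⟨ ∑-const units (2 * p) ⟨
    ∑ units (λ _ → 2 * p)                                         ≤⟨ ∑-mono-∈ units (λ {s} s∈ → *-monoʳ-≤ 2 (scale s (proj₂ (∈-filter⁻ nonzero? {xs = scalars} s∈)))) ⟩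
    ∑ units (λ s → 2 * ∑ V (λ z → ⟦ (s · z) ∈? poor-bad ⟧))       ≡⟨ *-∑ 2 units _ ⟨
    2 * ∑ units (λ s → ∑ V (λ z → ⟦ (s · z) ∈? poor-bad ⟧))       ≡⟨ cong (2 *_) (∑-swap units V _) ⟩
    2 * ∑ V (λ z → ∑ units (λ s → ⟦ (s · z) ∈? poor-bad ⟧))       ≡⟨ *-∑ 2 V _ ⟩
    ∑ V (λ z → 2 * ∑ units (λ s → ⟦ (s · z) ∈? poor-bad ⟧))       ≤⟨ ∑-mono V poor-multiples-≤ ⟩
    ∑ V (λ z → ⟦ bad? z ⟧ * q)                                    ≡⟨ ∑-* V _ q ⟨
    #bad * q                                                      ≡⟨ *-comm #bad q ⟩
    q * #bad                                                      ≤⟨ q*#bad≤r*n ⟩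
    r * n                                                         ∎
    where
    open ≤-Reasoning
    p = length poor-bad
    scale : ∀ s → s ≢ 0# → p ≤ ∑ V (λ z → ⟦ (s · z) ∈? poor-bad ⟧)
    scale s s≢0 with inverse s s≢0
    ... | i , si≡1 = length≤∑-preimage _≟ᵥ_ (Unique-filter⁺ poor-bad? E-unique) V (s ·_)
      (λ {y} _ → i · y , ∈-vectors _ , trans (·-· s i y) (trans (cong (_· y) si≡1) (1· y)))

  -- Combining the counts for large and for small q

  n≤#good+#rich+#poor-bad : n ≤ #good + (#rich + length poor-bad)
  n≤#good+#rich+#poor-bad = begin
    n                                                                ≡⟨ ∑-1 E ⟨
    ∑ E (λ _ → 1)                                                    ≤⟨ ∑-mono E trichotomy ⟩
    ∑ E (λ x → ⟦ good? x ⟧ + (⟦ rich? x ⟧ + ⟦ poor-bad? x ⟧))        ≡⟨ ∑-+ E _ _ ⟩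
    ∑ E (λ x → ⟦ good? x ⟧) + ∑ E (λ x → ⟦ rich? x ⟧ + ⟦ poor-bad? x ⟧) ≡⟨ cong₂ _+_ (sym (length-filter-∑ good? E)) (∑-+ E _ _) ⟩
    #good + (#rich + ∑ E (λ x → ⟦ poor-bad? x ⟧))                    ≡⟨ cong (λ p → #good + (#rich + p)) (length-filter-∑ poor-bad? E) ⟨
    #good + (#rich + length poor-bad)                                ∎
    where
    open ≤-Reasoning
    trichotomy : ∀ x → 1 ≤ ⟦ good? x ⟧ + (⟦ rich? x ⟧ + ⟦ poor-bad? x ⟧)
    trichotomy x with good? x | rich? x
    ... | yes _ | _     = s≤s z≤n
    ... | no  _ | yes _ = s≤s z≤n
    ... | no  _ | no  _ = s≤s z≤n

  n≤4*#good : 48 ≤ q → n ≤ 4 * #good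
  n≤4*#good 48≤q@(s≤s 47≤r) with n ≤? 4 * #good
  ... | yes n≤ = n≤
  -- With fewer than n/4 good points and at most n/2 bad vectors, 4n would be below n + 2n.
  ... | no  n≰ = contradiction (+-mono-<-≤ 4g<n 4b≤2n) (≤⇒≯ (begin
    n + 2 * n                 ≤⟨ m≤m+n (n + 2 * n) n ⟩
    n + 2 * n + n             ≡⟨ four n ⟩
    4 * n                     ≤⟨ *-monoʳ-≤ 4 n≤#good+#bad ⟩
    4 * (#good + #bad)        ≡⟨ *-distribˡ-+ 4 #good #bad ⟩
    4 * #good + 4 * #bad      ∎))
    where
    open ≤-Reasoning
    p = length poor-bad
    instance
      r-nonZero : NonZero r
      r-nonZero = ≢-nonZero λ { refl → contradiction 47≤r λ () }
    4g<n : 4 * #good < n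
    4g<n = ≰⇒> n≰
    four : ∀ n → n + 2 * n + n ≡ 4 * n
    four = solve-∀
    distribute : ∀ g ρ p → 4 * (g + (ρ + p)) ≡ 4 * ρ + (4 * g + 2 * (2 * p))
    distribute = solve-∀
    2p≤n : 2 * p ≤ n
    2p≤n = *-cancelˡ-≤ r r*2*#poor-bad≤r*n
    n≤4ρ : n ≤ 4 * #rich
    -- Good points account for less than n/4 and poor bad points for at most n/2, so at least n/4
    -- points are rich.
    n≤4ρ = +-cancelʳ-≤ (n + 2 * n) _ _ (begin
      n + (n + 2 * n)                              ≡⟨ trans (+-comm n _) (four n) ⟩
      4 * n                                        ≤⟨ *-monoʳ-≤ 4 n≤#good+#rich+#poor-bad ⟩
      4 * (#good + (#rich + p))                    ≡⟨ distribute #good #rich p ⟩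
      4 * #rich + (4 * #good + 2 * (2 * p))        ≤⟨ +-monoʳ-≤ (4 * #rich) (+-mono-≤ (<⇒≤ 4g<n) (*-monoʳ-≤ 2 2p≤n)) ⟩
      4 * #rich + (n + 2 * n)                      ∎)
    square : ∀ ρ → 3 * ((4 * ρ) * (4 * ρ)) ≡ 48 * (ρ * ρ)
    square = solve-∀
    q*2b≤r*n : q * (#bad * 2) ≤ r * n
    q*2b≤r*n = #bad-≤ 2 λ y bad-y → begin
      3 * (n * n)                          ≤⟨ *-monoʳ-≤ 3 (*-mono-≤ n≤4ρ n≤4ρ) ⟩
      3 * ((4 * #rich) * (4 * #rich))      ≡⟨ square #rich ⟩
      -- The threshold 48 is 3 · 4²: the factor 4² comes from n ≤ 4ρ, and 3 is `suc m` for m = 2 in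
      -- `#bad-≤`.
      48 * (#rich * #rich)                 ≤⟨ *-mono-≤ 48≤q (#rich²≤collisions y bad-y) ⟩
      q * collisions y                     ∎
    double : ∀ b → 4 * b ≡ 2 * (b * 2)
    double = solve-∀
    4b≤2n : 4 * #bad ≤ 2 * n
    4b≤2n = ≤-trans (≤-reflexive (double #bad)) (*-monoʳ-≤ 2
      (*-cancelˡ-≤ q (≤-trans q*2b≤r*n (*-monoˡ-≤ n (n≤1+n r)))))

  n≤48*#good : n ≤ 48 * #good
  n≤48*#good with 48 ≤? q
  ... | yes 48≤q = ≤-trans (n≤4*#good 48≤q) (*-monoˡ-≤ #good (m≤m+n 4 44))
  -- For bounded q the loss of a factor q in `n≤q*#good` is itself bounded.
  ... | no  48≰q = ≤-trans n≤q*#good (*-monoˡ-≤ #good (<⇒≤ (≰⇒> 48≰q)))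

theorem2p4 : (d : ℕ) → Σ ℕ λ N → NonZero N ×
    ((p k q : ℕ) → Prime p → ¬ (p ≡ 2) → q ≡ p ^ k → (𝔽 : FiniteField q) →
    (E : List (Vec (FiniteField.F 𝔽) d)) → Unique E →
    q ^ (suc d) ≤ length E * length E →
    Σ (List (Vec (FiniteField.F 𝔽) d)) λ E' → Unique E' × All (_∈ E) E' ×
    length E ≤ N * length E' ×
    All (λ y → q < 2 * projCard 𝔽 y E) E')
theorem2p4 d = 48 , _ , pinned
  where
  pinned : (p k q : ℕ) → Prime p → ¬ (p ≡ 2) → q ≡ p ^ k → (𝔽 : FiniteField q) →
    (E : List (Vec (FiniteField.F 𝔽) d)) → Unique E →
    q ^ (suc d) ≤ length E * length E →
    Σ (List (Vec (FiniteField.F 𝔽) d)) λ E' → Unique E' × All (_∈ E) E' ×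
    length E ≤ 48 * length E' ×
    All (λ y → q < 2 * projCard 𝔽 y E) E'
  -- A field has an element 0, so it cannot be in bijection with `Fin 0`; otherwise q is a successor
  -- and `Pinned` applies, with the good points of E as the subset.
  pinned _ _ zero    _ _ _ 𝔽 _ _ _ with Inverse.to (FiniteField.enum 𝔽) (FiniteField.0# 𝔽)
  ... | ()
  pinned _ _ (suc r) _ _ _ 𝔽 E E-unique large =
    filter good? E ,
    Unique-filter⁺ good? E-unique ,
    All.tabulate (λ x∈ → proj₁ (∈-filter⁻ good? {xs = E} x∈)) ,
    n≤48*#good ,
    all-filter good? E
    where open Pinned 𝔽 E E-unique large
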